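{- Let $T$ be a thick tree with loops with vertex set $V$ and sink $s\in V$, let $V_0=V\setminus\{s\}$, and let $\mathbf e^T\in\mathbb{Z}_{\ge0}^{V_0}$ be the identity element of its sandpile group (the identity configuration). Then $\mathbf e^T$ is given recursively, for $j\in V_0$, by $$e^T_j=\begin{cases}0, & \text{if } j\text{ is a leaf},\\ \lambda_j e_{j,p(j)}-\sum_{i\succ j}e^T_i, & \text{otherwise},\end{cases}$$ where $$\lambda_j=\left\lfloor\frac{\deg(j)+\sum_{i\succ j}e^T_i-1}{e_{j,p(j)}}\right\rfloor.$$
   Context: Graphs are finite, connected, undirected, with multiple edges and loops allowed. For vertices $i,j$, $e_{i,j}$ is the number of edges with endpoint set $\{i,j\}$ (so $e_{i,i}$ is the number of loops at $i$), and $\deg(i)=\sum_{j\in V}e_{i,j}$, so each loop is counted once. A distinguished vertex $s\in V$ is called the sink; $V_0=V\setminus\{s\}$. Thick tree with loops: a graph $T$ such that the simple graph $T'$ obtained by deleting all loops and reducing all nonzero edge multiplicities to $1$ is a tree. A leaf is a vertex $i\ne s$ of degree $1$ in $T'$. For $i,j\in V$, write $i\succeq j$ if $j$ lies on the unique path in $T'$ from $i$ to $s$ (endpoints included), and $i\succ j$ if moreover $i\ne j$. For $j\in V_0$, the parent $p(j)$ is the neighbour of $j$ in $T'$ lying on the path from $j$ to $s$ (i.e. $p(j)$ is adjacent to $j$ and $j\succ p(j)$). Sandpile model: a configuration is a vector $\mathbf u\in\mathbb{Z}_{\ge0}^{V_0}$. A vertex $i\in V_0$ is stable for $\mathbf u$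 if $u_i<\deg(i)$, otherwise unstable; $\mathbf u$ is stable if all vertices of $V_0$ are. Toppling an unstable vertex $i$ replaces $u_i$ by $u_i-\deg(i)+e_{i,i}$ and $u_j$ by $u_j+e_{i,j}$ for each $j\in V_0$, $j\ne i$. Repeatedly toppling unstable vertices leads, in finitely many steps, to a stable configuration that is independent of the choices, denoted $\sigma(\mathbf u)$ (the stabilization). Put $\mathbf u\oplus\mathbf v=\sigma(\mathbf u+\mathbf v)$. A configuration $\mathbf u$ is recurrent if for every configuration $\mathbf v$ there is a configuration $\mathbf w$ with $\mathbf v\oplus\mathbf w=\mathbf u$. The set $G$ of recurrent configurations is an abelian group under $\oplus$ (known), called the sandpile group.
   Formalization: The value 0 is claimed only at leaves without loops; a leaf carrying loops falls under the "otherwise" formula, since the printed leaf clause is false there (one edge to s and one loop at j give e_j = 1). -}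

module Defs where

open import Algebra.Properties.CommutativeMonoid.Sum as Sum using ()
open import Data.Bool.Base using (if_then_else_)
open import Data.Fin.Base using (Fin; punchIn)
open import Data.Fin.Properties using (_≟_; punchInᵢ≢i)
open import Data.List.Base using (List; []; _∷_; length; filter; allFin)
open import Data.List.Membership.DecPropositional using () renaming (_∈?_ to mem?)
open import Data.List.Membership.Propositional using (_∈_)
open import Data.List.Relation.Unary.Any using (here; there)
open import Data.List.Relation.Unary.Unique.Propositional using (Unique)
open import Data.Nat.Base using (ℕ; suc; _+_; _*_; _∸_; _≤_; _<_; _/_; NonZero)
open import Data.Nat.Properties using (+-0-commutativeMonoid; nonZero?)
open import Data.Product using (_×_; _,_; ∃; ∃!; ∃-syntax; proj₁; proj₂)
open import Data.Vec.Base using (Vec; lookup; tabulate; zipWith)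
open import Relation.Binary.Construct.Closure.ReflexiveTransitive using (Star)
open import Relation.Binary.PropositionalEquality
  using (_≡_; _≢_; refl; sym)
open import Relation.Nullary.Decidable using (Dec; does; ¬?; _×-dec_)
open import Relation.Nullary.Negation using (contradiction)

open Sum +-0-commutativeMonoid using (sum) public

-- A multigraph with loops is given by its edge multiplicities:
-- e i j is the number of edges with endpoint set {i , j}.
record Multigraph (n : ℕ) : Set where
  field
    e     : Fin n → Fin n → ℕ
    e-sym : ∀ i j → e i j ≡ e j i

  -- The summand j = i counts every loop once.
  deg : Fin n → ℕ
  deg i = sum (λ j → e i j)

  -- Adjacency in the simple graph T′ obtained by deleting all loops and
  -- reducing all nonzero multiplicities to 1.
  infix 4 _~_ _~?_
  _~_ : Fin n → Fin n → Set
  i ~ j = i ≢ j × NonZero (e i j)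

  _~?_ : ∀ i j → Dec (i ~ j)
  i ~? j = ¬? (i ≟ j) ×-dec nonZero? (e i j)

  deg′ : Fin n → ℕ
  deg′ i = length (filter (i ~?_) (allFin n))

  -- Walk i ks k : the list ks is the vertex sequence of a walk in T′ from
  -- i to k, both endpoints included.
  data Walk : Fin n → List (Fin n) → Fin n → Set where
    stop : ∀ {i} → Walk i (i ∷ []) i
    step : ∀ {i j k ks} → i ~ j → Walk j ks k → Walk i (i ∷ ks) k

  Path : Fin n → Fin n → List (Fin n) → Set
  Path i k ks = Walk i ks k × Unique ks

  -- T′ is a tree: any two vertices are joined by exactly one path.
  IsThickTree : Set
  IsThickTree = ∀ i k → ∃! _≡_ (Path i k)

-- There is at least one vertex, the sink, so the number of vertices is
-- written suc m.
record ThickTree (m : ℕ) : Set where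
  field
    graph : Multigraph (suc m)
    s     : Fin (suc m)
    tree  : Multigraph.IsThickTree graph

  open Multigraph graph public

module Sandpile {m : ℕ} (T : ThickTree m) where
  open ThickTree T public

  V V₀ : Set
  V  = Fin (suc m)
  V₀ = Fin m

  -- V₀ indexes the non-sink vertices: punchIn s is a bijection from Fin m
  -- onto the vertices different from s.
  ι : V₀ → V
  ι = punchIn s

  pathToSink : V → List V
  pathToSink i = proj₁ (tree i s)

  infix 4 _⪰_ _≻_ _≻?_
  _⪰_ _≻_ : V → V → Set
  i ⪰ j = j ∈ pathToSink i
  i ≻ j = i ⪰ j × i ≢ j

  _≻?_ : ∀ i j → Dec (i ≻ j)
  i ≻? j = mem? _≟_ j (pathToSink i) ×-dec ¬? (i ≟ j)

  Leaf : V₀ → Set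
  Leaf j = deg′ (ι j) ≡ 1

  -- A leaf carrying k ≥ 1 loops has identity value different from 0 (for one
  -- simple edge to s and one loop it is 1), so the clause "0 at a leaf" is
  -- valid exactly at the leaves without loops.
  LooplessLeaf : V₀ → Set
  LooplessLeaf j = Leaf j × e (ι j) (ι j) ≡ 0

  IsParent : V₀ → V → Set
  IsParent j p = ι j ~ p × ι j ≻ p

  private
    source∈ : ∀ {i k ks} → Walk i ks k → i ∈ ks
    source∈ stop       = here refl
    source∈ (step _ _) = here refl

    next : ∀ {i k ks} → i ≢ k → Walk i ks k → ∃[ p ] i ~ p × p ∈ ks
    next i≢k stop       = contradiction refl i≢k
    next i≢k (step a w) = _ , a , there (source∈ w)

  parent : ∀ j → ∃ (IsParent j)
  parent j with next (punchInᵢ≢i s j) (proj₁ (proj₁ (proj₂ (tree (ι j) s))))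
  ... | p , a , p∈ = p , a , p∈ , proj₁ a

  p : V₀ → V
  p j = proj₁ (parent j)

  instance
    e-parent-nonZero : ∀ {j} → NonZero (e (ι j) (p j))
    e-parent-nonZero {j} = proj₂ (proj₁ (proj₂ (parent j)))

  Config : Set
  Config = Vec ℕ m

  Stable Unstable : Config → V₀ → Set
  Stable   u i = lookup u i < deg (ι i)
  Unstable u i = deg (ι i) ≤ lookup u i

  -- The subtraction is exact whenever i is unstable, the only case in which
  -- topple is used.
  topple : V₀ → Config → Config
  topple i u = tabulate λ j →
    if does (j ≟ i)
    then (lookup u i ∸ deg (ι i)) + e (ι i) (ι i)
    else lookup u j + e (ι i) (ι j)

  infix 4 _⟶_ _⇓_ _⊕_≐_
  _⟶_ : Config → Config → Set
  u ⟶ v = ∃[ i ] Unstable u i × v ≡ topple i u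

  -- The graph of the stabilization map: u ⇓ v says v = σ(u).  For each u
  -- there is exactly one such v.
  _⇓_ : Config → Config → Set
  u ⇓ v = Star _⟶_ u v × (∀ i → Stable v i)

  -- u ⊕ v ≐ w says that σ(u + v) = w.
  _⊕_≐_ : Config → Config → Config → Set
  u ⊕ v ≐ w = zipWith _+_ u v ⇓ w

  Recurrent : Config → Set
  Recurrent u = ∀ v → ∃[ w ] v ⊕ w ≐ u

  IsIdentity : Config → Set
  IsIdentity u = Recurrent u × (∀ v → Recurrent v → u ⊕ v ≐ v × v ⊕ u ≐ v)

  -- Σ_{i ≻ j} u_i; every such i is in V₀, since s ≻ j holds for no j.
  sumAbove : Config → V₀ → ℕ
  sumAbove u j = sum λ i → if does (ι i ≻? ι j) then lookup u i else 0

  -- The subtraction of 1 is exact: deg (ι j) ≥ e (ι j) (p j) ≥ 1.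
  lam : Config → V₀ → ℕ
  lam u j = (deg (ι j) + sumAbove u j ∸ 1) / e (ι j) (p j)

{-# OPTIONS --safe #-}

-- Write A for the set of vertices i ⪰ j, E for e (ι j) (p j) and S for
-- sumAbove eᵀ j.  The only edges leaving A join j to p j, and this determines
-- eᵀ_j as follows.
--
-- Stabilizing eᵀ + eᵀ to eᵀ exhibits eᵀ as the reduced Laplacian applied to a
-- firing vector x.  Summed over A, everything inside A cancels, and
-- eᵀ_j + S + x_{p j} E = x_j E; hence E divides eᵀ_j + S.
--
-- Stabilize a configuration that is unstable everywhere to eᵀ, and look at the
-- vertex i of A whose last toppling is earliest: afterwards all its neighbours
-- in A topple, so eᵀ_i is at least the number of edges from i into A.  By
-- stability i = j, so deg j - E ≤ eᵀ_j < deg j.  Together with divisibility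
-- this forces eᵀ_j + S = λ_j E.  At a loopless leaf S = 0 and deg j = E, so E
-- divides eᵀ_j < E.
module Submission where

open import Defs
import Algebra.Properties.CommutativeMonoid.Sum
import Algebra.Properties.Semiring.Sum
open import Data.Bool.Base using (if_then_else_)
open import Data.Fin.Base using (Fin; punchIn; punchOut)
open import Data.Fin.Properties using (_≟_; punchInᵢ≢i; punchIn-injective; punchIn-punchOut)
import Data.Integer.Properties as ℤ
open import Data.List.Base using (List; []; _∷_; length; filter; allFin)
open import Data.List.Membership.DecPropositional using () renaming (_∈?_ to mem?)
open import Data.List.Membership.Propositional using (_∈_; _∉_)
open import Data.List.Membership.Propositional.Properties using (∈-filter⁺; ∈-allFin)
open import Data.List.Properties using (∷-injectiveʳ)
open import Data.List.Relation.Binary.Subset.Propositional using (_⊆_)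
open import Data.List.Relation.Unary.All using ([])
open import Data.List.Relation.Unary.All.Properties using (All¬⇒¬Any; ¬Any⇒All¬)
open import Data.List.Relation.Unary.AllPairs using ([]; _∷_)
open import Data.List.Relation.Unary.Any using (here; there)
open import Data.List.Relation.Unary.Unique.Propositional using (Unique)
open import Data.Nat.Base
open import Data.Nat.Divisibility using (_∣_; divides; ∣⇒≤; n∣m*n; ∣m+n∣m⇒∣n)
open import Data.Nat.DivMod using (+-distrib-/-∣ˡ; m*n/n≡m; m<n⇒m/n≡0)
open import Data.Nat.Properties hiding (_≟_)
open import Data.Nat.Solver using (module +-*-Solver)
open import Data.Product using (_×_; _,_; proj₁; proj₂; ∃-syntax)
open import Data.Vec.Base using (lookup; tabulate; zipWith)
open import Data.Vec.Properties using (lookup∘tabulate; lookup-zipWith)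
open import Function.Base using (id; _∘_)
open import Relation.Binary.Construct.Closure.ReflexiveTransitive using (Star; ε; _◅_)
open import Relation.Binary.PropositionalEquality
  using (_≡_; _≢_; refl; sym; trans; cong; cong₂; subst; module ≡-Reasoning)
open import Relation.Nullary.Decidable using (Dec; yes; no; does; dec-true; dec-false)
open import Relation.Nullary.Negation using (¬_; contradiction)

open Algebra.Properties.Semiring.Sum +-*-semiring
  using (*-distribˡ-sum)
open Algebra.Properties.CommutativeMonoid.Sum +-0-commutativeMonoid
  using (sum-remove; sum-replicate-zero; ∑-distrib-+; ∑-comm) renaming (sum-cong-≗ to sum-cong)

-- Indicators, finite sums and floor division

[_] : ∀ {a} {P : Set a} → Dec P → ℕ
[ d ] = if does d then 1 else 0

[]-true : ∀ {a} {P : Set a} (d : Dec P) → P → [ d ] ≡ 1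
[]-true d x = cong (if_then 1 else 0) (dec-true d x)

[]-false : ∀ {a} {P : Set a} (d : Dec P) → ¬ P → [ d ] ≡ 0
[]-false d ¬x = cong (if_then 1 else 0) (dec-false d ¬x)

[]≤1 : ∀ {a} {P : Set a} (d : Dec P) → [ d ] ≤ 1
[]≤1 (yes _) = ≤-refl
[]≤1 (no  _) = z≤n

sum-zero : ∀ {n} (f : Fin n → ℕ) → (∀ i → f i ≡ 0) → sum f ≡ 0
sum-zero {n} f f≡0 = trans (sum-cong f≡0) (sum-replicate-zero n)

sum-mono : ∀ {n} {f g : Fin n → ℕ} → (∀ i → f i ≤ g i) → sum f ≤ sum g
sum-mono {zero}  f≤g = z≤n
sum-mono {suc n} f≤g = +-mono-≤ (f≤g Fin.zero) (sum-mono (f≤g ∘ Fin.suc))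

sum-punchIn : ∀ {n} (i : Fin (suc n)) (f : Fin (suc n) → ℕ) → f i ≡ 0 → sum f ≡ sum (f ∘ punchIn i)
sum-punchIn i f fi≡0 = trans (sum-remove {i = i} f) (cong (_+ sum (f ∘ punchIn i)) fi≡0)

sum-δ : ∀ {n} (i : Fin n) (f : Fin n → ℕ) → sum (λ k → [ i ≟ k ] * f k) ≡ f i
sum-δ {suc n} i f = begin
  sum g                        ≡⟨ sum-remove {i = i} g ⟩
  g i + sum (g ∘ punchIn i)    ≡⟨ cong₂ _+_ (cong (_* f i) ([]-true (i ≟ i) refl)) (sum-zero _ off) ⟩
  1 * f i + 0                  ≡⟨ trans (+-identityʳ _) (*-identityˡ _) ⟩
  f i                          ∎
  where
  open ≡-Reasoning
  g = λ k → [ i ≟ k ] * f k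
  off : ∀ k → g (punchIn i k) ≡ 0
  off k = cong (_* f (punchIn i k)) ([]-false (i ≟ punchIn i k) (punchInᵢ≢i i k ∘ sym))

length-1⇒≡ : ∀ {a} {A : Set a} {xs : List A} {x y} → length xs ≡ 1 → x ∈ xs → y ∈ xs → x ≡ y
length-1⇒≡ {xs = _ ∷ []} _ (here refl) (here refl) = refl

multiple<⇒≡0 : ∀ {m n} → n ∣ m → m < n → m ≡ 0
multiple<⇒≡0 {zero}  _   _   = refl
multiple<⇒≡0 {suc _} n∣m m<n = contradiction (∣⇒≤ n∣m) (<⇒≱ m<n)

-- Write `d` as `x` + 1 + `r`; the upper bound on `d` gives `r` < `n`. The numerator is then
-- `q * n + r`, and the division discards `r`.
quotient-in-window : ∀ x y q {d n} .{{_ : NonZero n}} →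
  x < d → d ≤ x + n → x + y ≡ q * n → (d + y ∸ 1) / n ≡ q
quotient-in-window x y q {n = n} x<d d≤x+n eq with m≤n⇒∃[o]m+o≡n x<d
... | r , refl = begin
  (x + r + y) / n       ≡⟨ cong (_/ n) (solve 3 (λ x r y → x :+ r :+ y := x :+ y :+ r) refl x r y) ⟩
  (x + y + r) / n       ≡⟨ cong (λ z → (z + r) / n) eq ⟩
  (q * n + r) / n       ≡⟨ +-distrib-/-∣ˡ r (n∣m*n q) ⟩
  q * n / n + r / n     ≡⟨ cong₂ _+_ (m*n/n≡m q n) (m<n⇒m/n≡0 r<n) ⟩
  q + 0                 ≡⟨ +-identityʳ q ⟩
  q                     ∎
  where
  open ≡-Reasoning
  open +-*-Solver
  r<n : r < n
  r<n = +-cancelˡ-≤ x _ _ (subst (_≤ x + n) (sym (+-suc x r)) d≤x+n)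

module _ {m : ℕ} (T : ThickTree m) where
  open Sandpile T

  -- Paths to the sink in the tree

  private variable
    i j k l : V
    ks : List V

  ~-sym : i ~ k → k ~ i
  ~-sym {i} {k} (i≢k , nz) = i≢k ∘ sym , subst NonZero (e-sym i k) nz

  pathToSink-isPath : ∀ i → Path i s (pathToSink i)
  pathToSink-isPath i = proj₁ (proj₂ (tree i s))

  pathToSink-unique : Path i s ks → pathToSink i ≡ ks
  pathToSink-unique {i} = proj₂ (proj₂ (tree i s))

  source∈ : Walk i ks k → i ∈ ks
  source∈ stop       = here refl
  source∈ (step _ _) = here refl

  ⪰-refl : ∀ i → i ⪰ i
  ⪰-refl i = source∈ (proj₁ (pathToSink-isPath i))

  source-unique : ∀ {ls} → Path i l (j ∷ ls) → i ≡ j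
  source-unique (stop     , _) = refl
  source-unique (step _ _ , _) = refl

  -- The inclusion is kept so that a vertex missing from the longer path is also missing from the
  -- suffix; `tail-path` needs this to prepend a vertex.
  suffix : Path i l ks → k ∈ ks → ∃[ ls ] Path k l ls × ls ⊆ ks
  suffix p@(stop     , _)     (here refl) = _ , p , id
  suffix p@(step _ _ , _)     (here refl) = _ , p , id
  suffix (step _ w   , _ ∷ u) (there k∈) with suffix (w , u) k∈
  ... | ls , p , ls⊆ = ls , p , there ∘ ls⊆

  cons-path : i ~ k → Path k l ks → i ∉ ks → Path i l (i ∷ ks)
  cons-path a (w , u) i∉ = step a w , ¬Any⇒All¬ _ i∉ ∷ u

  -- The edge from `i` to `k` short-cuts whatever stretch of the path lies between them.
  tail-path : ∀ {ls} → i ~ k → Path i l ls → k ∈ ls → ∃[ ks ] Path i l (i ∷ ks) × Path k l ks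
  tail-path (i≢k , _) p                   (here refl) = contradiction (source-unique p) i≢k
  tail-path a         (step _ w , i≢ ∷ u) (there k∈) with suffix (w , u) k∈
  ... | ks , p , ks⊆ = ks , cons-path a p (All¬⇒¬Any i≢ ∘ ks⊆) , p

  -- Uniqueness identifies the short-cut path with the original one. Together with `~∉⇒pathToSink`
  -- this covers both directions in which a tree edge can point.
  ~∈⇒pathToSink : i ~ k → i ⪰ k → pathToSink i ≡ i ∷ pathToSink k
  ~∈⇒pathToSink {i} a k∈ with tail-path a (pathToSink-isPath i) k∈
  ... | ks , p , q = trans (pathToSink-unique p) (cong (i ∷_) (sym (pathToSink-unique q)))

  ~∉⇒pathToSink : i ~ k → ¬ i ⪰ k → pathToSink k ≡ k ∷ pathToSink i
  ~∉⇒pathToSink {i} a k∉ = pathToSink-unique (cons-path (~-sym a) (pathToSink-isPath i) k∉)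

  infix 4 _⪰?_
  _⪰?_ : ∀ i j → Dec (i ⪰ j)
  i ⪰? j = mem? _≟_ j (pathToSink i)

  -- A single step towards the sink goes no further than `j`, and a step away from the sink only
  -- lengthens the path.
  ≻-neighbour : i ≻ j → i ~ k → k ⪰ j
  ≻-neighbour {i} {k = k} (i⪰j , i≢j) a with i ⪰? k
  ... | no  k∉ = subst (_ ∈_) (sym (~∉⇒pathToSink a k∉)) (there i⪰j)
  ... | yes k∈ with subst (_ ∈_) (~∈⇒pathToSink a k∈) i⪰j
  ...   | here j≡i = contradiction (sym j≡i) i≢j
  ...   | there j∈ = j∈

  sink-minimal : s ⪰ j → j ≡ s
  sink-minimal j∈ with subst (_ ∈_) (pathToSink-unique (stop , [] ∷ [])) j∈
  ... | here j≡s = j≡s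

  -- `k` is the vertex just before `j` on the path. It gives a non-sink `j` a neighbour other than
  -- its parent, which no leaf has.
  child : Path i s ks → j ∈ ks → i ≢ j → ∃[ k ] j ~ k × k ≻ j
  child p (here refl) i≢j = contradiction (source-unique p) i≢j
  child {i} {j = j} (step {j = k} a w , u₀@(_ ∷ u)) (there j∈) i≢j with k ≟ j
  ... | no  k≢j = child (w , u) j∈ k≢j
  ... | yes refl = i , ~-sym a ,
    subst (j ∈_) (sym (pathToSink-unique (step a w , u₀))) (there j∈) , i≢j

  pathToSink-injective : pathToSink i ≡ pathToSink k → i ≡ k
  pathToSink-injective {i} {k} eq =
    same-source (pathToSink-isPath i) (subst (Path k s) (sym eq) (pathToSink-isPath k))
    where
    same-source : ∀ {ls} → Path i s ls → Path k s ls → i ≡ k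
    same-source {[]}    (() , _)
    same-source {_ ∷ _} p q = trans (source-unique p) (sym (source-unique q))

  -- Toppling sequences and their firing vectors

  topple-balance : ∀ k u i → Unstable u k →
    lookup (topple k u) i + [ ι k ≟ ι i ] * deg (ι i) ≡ lookup u i + e (ι k) (ι i)
  topple-balance k u i unst rewrite lookup∘tabulate
    (λ j → if does (j ≟ k) then (lookup u k ∸ deg (ι k)) + e (ι k) (ι k)
                           else lookup u j + e (ι k) (ι j)) i
    with i ≟ k | ι k ≟ ι i
  ... | yes refl | yes _   = begin
    x ∸ d + c + 1 * d ≡⟨ solve 3 (λ y c d → y :+ c :+ con 1 :* d := y :+ d :+ c) refl (x ∸ d) c d ⟩
    -- Instability makes the truncated subtraction in `topple` exact.
    x ∸ d + d + c     ≡⟨ cong (_+ c) (m∸n+n≡m unst) ⟩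
    x + c             ∎
    where
    open ≡-Reasoning
    open +-*-Solver
    x = lookup u k
    d = deg (ι k)
    c = e (ι k) (ι k)
  ... | yes refl | no k≢k  = contradiction refl k≢k
  ... | no i≢k   | yes k≡i = contradiction (sym (punchIn-injective s k i k≡i)) i≢k
  ... | no _     | no _    = +-identityʳ _

  private variable
    u v : Config

  -- The firing vector, extended to all of `V` with value 0 at the sink, so that edge sums can run
  -- over every vertex.
  fires : Star _⟶_ u v → V → ℕ
  fires ε             k = 0
  fires ((i , _) ◅ r) k = [ ι i ≟ k ] + fires r k

  -- This is v = u - Δf for the reduced Laplacian Δ and the firing vector f, with both negative
  -- terms moved across. A loop occurs once in `deg` and once in the sum at `k` = `ι i`, so it
  -- cancels.
  balance : (r : Star _⟶_ u v) (i : V₀) →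
    lookup v i + fires r (ι i) * deg (ι i) ≡ lookup u i + sum (λ k → fires r k * e k (ι i))
  balance {v = v} ε i = cong (lookup v i +_) (sym (sum-zero {suc m} _ (λ _ → refl)))
  balance {u} {v} ((k , unst , refl) ◅ r) i = begin
    lookup v i + ([ ι k ≟ ι i ] + f (ι i)) * d
      ≡⟨ solve 4 (λ v a f d → v :+ (a :+ f) :* d := v :+ f :* d :+ a :* d) refl
           (lookup v i) [ ι k ≟ ι i ] (f (ι i)) d ⟩
    lookup v i + f (ι i) * d + [ ι k ≟ ι i ] * d
      ≡⟨ cong (_+ [ ι k ≟ ι i ] * d) (balance r i) ⟩
    lookup (topple k u) i + rest + [ ι k ≟ ι i ] * d
      ≡⟨ solve 3 (λ t r a → t :+ r :+ a := t :+ a :+ r) refl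
           (lookup (topple k u) i) rest ([ ι k ≟ ι i ] * d) ⟩
    lookup (topple k u) i + [ ι k ≟ ι i ] * d + rest
      ≡⟨ cong (_+ rest) (topple-balance k u i unst) ⟩
    lookup u i + e (ι k) (ι i) + rest
      ≡⟨ +-assoc (lookup u i) _ _ ⟩
    lookup u i + (e (ι k) (ι i) + rest)
      -- The chips sent by the first toppling become a sum against an indicator, ready to merge with
      -- the later firings.
      ≡⟨ cong (λ x → lookup u i + (x + rest)) (sum-δ (ι k) (λ l → e l (ι i))) ⟨
    lookup u i + (sum (λ l → [ ι k ≟ l ] * e l (ι i)) + rest)
      ≡⟨ cong (λ x → lookup u i + x) (trans (sum-cong (λ l → *-distribʳ-+ (e l (ι i)) [ ι k ≟ l ] (f l)))
                                            (∑-distrib-+ (λ l → [ ι k ≟ l ] * e l (ι i)) (λ l → f l * e l (ι i)))) ⟨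
    lookup u i + sum (λ l → ([ ι k ≟ l ] + f l) * e l (ι i)) ∎
    where
    open ≡-Reasoning
    open +-*-Solver
    f = fires r
    d = deg (ι i)
    rest = sum (λ l → f l * e l (ι i))

  -- The vertex found is the one of χ whose last toppling is earliest.
  no-forbidden-subset : (r : Star _⟶_ u v) (χ : V → ℕ) → (∀ k → χ k ≤ 1) → (∀ k → χ k ≤ fires r k) →
    ∀ {j} → 1 ≤ χ j → ∃[ i ] 1 ≤ χ (ι i) × sum (λ k → χ k * e k (ι i)) ≤ lookup v i
  no-forbidden-subset ε χ _ χ≤f {j} 1≤χj = contradiction (≤-trans 1≤χj (χ≤f j)) λ ()
  no-forbidden-subset {u} {v} r₀@((i , unst , refl) ◅ r) χ χ≤1 χ≤f 1≤χj with χ (ι i) ≤? fires r (ι i)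
  ... | yes χi≤f = no-forbidden-subset r χ χ≤1 χ≤f′ 1≤χj
    where
    χ≤f′ : ∀ k → χ k ≤ fires r k
    χ≤f′ k with ι i ≟ k | χ≤f k
    ... | yes refl | _  = χi≤f
    ... | no _     | χk≤ = χk≤
  -- Here `ι i` lies in `χ` and never topples again, so it fires exactly once in `r₀`.
  ... | no χi≰f = i , ≤-trans (s≤s z≤n) f<χ , ≤-trans (sum-mono (λ k → *-monoˡ-≤ (e k (ι i)) (χ≤f k))) bound
    where
    open ≤-Reasoning
    f<χ : fires r (ι i) < χ (ι i)
    f<χ = ≰⇒> χi≰f
    f≡1 : fires r₀ (ι i) ≡ 1
    f≡1 = cong₂ _+_ ([]-true (ι i ≟ ι i) refl) (n<1⇒n≡0 (<-≤-trans f<χ (χ≤1 (ι i))))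
    bound : sum (λ k → fires r₀ k * e k (ι i)) ≤ lookup v i
    -- The initial chips at `i` already pay for its single toppling, so everything it receives, its
    -- own loops included, is still there at the end.
    bound = +-cancelˡ-≤ (deg (ι i)) _ _ (begin
      deg (ι i) + sum (λ k → fires r₀ k * e k (ι i))  ≤⟨ +-monoˡ-≤ _ unst ⟩
      lookup u i + sum (λ k → fires r₀ k * e k (ι i)) ≡⟨ balance r₀ i ⟨
      lookup v i + fires r₀ (ι i) * deg (ι i)         ≡⟨ cong (λ x → lookup v i + x * deg (ι i)) f≡1 ⟩
      lookup v i + 1 * deg (ι i)                      ≡⟨ cong (lookup v i +_) (*-identityˡ _) ⟩
      lookup v i + deg (ι i)                          ≡⟨ +-comm (lookup v i) _ ⟩
      deg (ι i) + lookup v i                          ∎)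

  -- A vertex that never topples only gains chips and would still be unstable at the end.
  fires-all : (r : Star _⟶_ u v) → (∀ i → Unstable u i) → (∀ i → Stable v i) → ∀ i → 1 ≤ fires r (ι i)
  fires-all {u} {v} r unst stable i with fires r (ι i) in f≡
  ... | suc _ = s≤s z≤n
  ... | zero = contradiction (unst i) (<⇒≱ (begin-strict
      lookup u i                                            ≤⟨ m≤m+n _ _ ⟩
      lookup u i + sum (λ k → fires r k * e k (ι i))        ≡⟨ balance r i ⟨
      lookup v i + fires r (ι i) * deg (ι i)                ≡⟨ cong (λ x → lookup v i + x * deg (ι i)) f≡ ⟩
      lookup v i + 0                                        ≡⟨ +-identityʳ _ ⟩
      lookup v i                                            <⟨ stable i ⟩
      deg (ι i)                                             ∎))
    where open ≤-Reasoning

  -- The set A and the edges leaving it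

  module _ (j : V₀) where
    private
      J P : V
      J = ι j
      P = p j
      J~P : J ~ P
      J~P = proj₁ (proj₂ (parent j))
      E : ℕ
      E = e J P

    parent-path : pathToSink J ≡ J ∷ pathToSink P
    parent-path = ~∈⇒pathToSink J~P (proj₁ (proj₂ (proj₂ (parent j))))

    parent-⋡ : ¬ P ⪰ J
    parent-⋡ J∈ with subst Unique parent-path (proj₂ (pathToSink-isPath J))
    ... | J∉ ∷ _ = All¬⇒¬Any J∉ J∈

    -- A neighbour lying on the path from `J` must come right after `J`, hence is `P`, because a
    -- path determines its source.
    neighbour-⪰ : J ~ k → k ≢ P → k ⪰ J
    neighbour-⪰ {k} a k≢P with J ⪰? k
    ... | no  k∉ = subst (J ∈_) (sym (~∉⇒pathToSink a k∉)) (there (⪰-refl J))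
    ... | yes k∈ = contradiction
      (pathToSink-injective (∷-injectiveʳ (trans (sym (~∈⇒pathToSink a k∈)) parent-path))) k≢P

    χ : V → ℕ
    χ v = [ v ⪰? J ]

    χ-sink : χ s ≡ 0
    χ-sink = []-false (s ⪰? J) (punchInᵢ≢i s j ∘ sink-minimal)

    -- The proviso excludes only the pair (`J`, `P`). Weighting by the edge count admits all other
    -- pairs: non-adjacent ones weigh 0, and loops stay at `v`.
    χ-closed : ∀ {v k} → v ⪰ J → (v ≡ J → k ≢ P) → χ k * e v k ≡ e v k
    χ-closed {v} {k} v⪰J ok with k ⪰? J | e v k in eq
    ... | yes _  | _ = *-identityˡ _
    ... | no  _  | zero = refl
    ... | no  k∉ | suc _ = contradiction (k⪰J (v ≟ k) (v ≟ J)) k∉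
      where
      v~k : v ≢ k → v ~ k
      v~k v≢k = v≢k , subst NonZero (sym eq) _
      k⪰J : Dec (v ≡ k) → Dec (v ≡ J) → k ⪰ J
      k⪰J (yes refl) _          = v⪰J
      k⪰J (no v≢k)   (yes refl) = neighbour-⪰ (v~k v≢k) (ok refl)
      k⪰J (no v≢k)   (no v≢J)   = ≻-neighbour (v⪰J , v≢J) (v~k v≢k)

    cut-edge : ∀ v k → χ v * e v k ≡ χ v * (χ k * e v k) + [ J ≟ v ] * ([ P ≟ k ] * E)
    cut-edge v k with v ⪰? J | J ≟ v | P ≟ k
    ... | no v∉ | yes refl | _ = contradiction (⪰-refl J) v∉
    ... | no v∉ | no _     | _ = refl
    ... | yes v∈ | no J≢v  | _ =
      trans (cong (1 *_) (sym (χ-closed v∈ (λ v≡J → contradiction (sym v≡J) J≢v)))) (sym (+-identityʳ _))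
    ... | yes v∈ | yes refl | no P≢k =
      trans (cong (1 *_) (sym (χ-closed v∈ (λ _ → P≢k ∘ sym)))) (sym (+-identityʳ _))
    -- `P` is outside A, so the first summand vanishes and the second carries all `E` edges.
    ... | yes v∈ | yes refl | yes refl =
      trans (sym (+-identityʳ _))
        (cong (λ x → 1 * (x * E) + 1 * (1 * E)) (sym ([]-false (P ⪰? J) parent-⋡)))

    -- The weight may depend on both ends because two instances are needed: chips sent, weighted by
    -- the firings of `v`, and chips received, weighted by those of `k`.
    sum-cut : (f : V → V → ℕ) → sum (λ v → sum (λ k → χ v * (f v k * e v k)))
                  ≡ sum (λ v → sum (λ k → χ v * χ k * (f v k * e v k))) + f J P * E
    sum-cut f = begin
      sum (λ v → sum (λ k → χ v * (f v k * e v k)))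
        ≡⟨ sum-cong (λ v → trans (sum-cong (split v)) (∑-distrib-+ (inner v) (outer v))) ⟩
      sum (λ v → sum (inner v) + sum (outer v))
        ≡⟨ ∑-distrib-+ (sum ∘ inner) (sum ∘ outer) ⟩
      sum (sum ∘ inner) + sum (sum ∘ outer)
        ≡⟨ cong (sum (sum ∘ inner) +_) (sum-cong λ v →
             trans (sym (*-distribˡ-sum [ J ≟ v ] (λ k → [ P ≟ k ] * (f v k * E))))
                   (cong ([ J ≟ v ] *_) (sum-δ P (λ k → f v k * E)))) ⟩
      sum (sum ∘ inner) + sum (λ v → [ J ≟ v ] * (f v P * E))
        ≡⟨ cong (sum (sum ∘ inner) +_) (sum-δ J (λ v → f v P * E)) ⟩
      sum (sum ∘ inner) + f J P * E ∎
      where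
      open ≡-Reasoning
      open +-*-Solver
      inner : V → V → ℕ
      inner v k = χ v * χ k * (f v k * e v k)
      outer : V → V → ℕ
      outer v k = [ J ≟ v ] * ([ P ≟ k ] * (f v k * E))
      split : ∀ v k → χ v * (f v k * e v k) ≡ inner v k + outer v k
      split v k = begin
        χ v * (f v k * e v k)
          ≡⟨ solve 3 (λ a b c → a :* (b :* c) := b :* (a :* c)) refl (χ v) (f v k) (e v k) ⟩
        f v k * (χ v * e v k)
          ≡⟨ cong (f v k *_) (cut-edge v k) ⟩
        f v k * (χ v * (χ k * e v k) + [ J ≟ v ] * ([ P ≟ k ] * E))
          ≡⟨ solve 7 (λ f a b c d g h → f :* (a :* (b :* c) :+ d :* (g :* h))
                        := a :* b :* (f :* c) :+ d :* (g :* (f :* h)))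
               refl (f v k) (χ v) (χ k) (e v k) [ J ≟ v ] [ P ≟ k ] E ⟩
        inner v k + outer v k ∎

    sum-χ : (u : Config) → sum (λ i → χ (ι i) * lookup u i) ≡ lookup u j + sumAbove u j
    sum-χ u = begin
      sum (λ i → χ (ι i) * lookup u i)
        ≡⟨ sum-cong split ⟩
      sum (λ i → [ j ≟ i ] * lookup u i + above i)
        ≡⟨ ∑-distrib-+ (λ i → [ j ≟ i ] * lookup u i) above ⟩
      sum (λ i → [ j ≟ i ] * lookup u i) + sum above
        ≡⟨ cong (_+ sum above) (sum-δ j (lookup u)) ⟩
      lookup u j + sumAbove u j ∎
      where
      open ≡-Reasoning
      above = λ i → if does (ι i ≻? J) then lookup u i else 0
      split : ∀ i → χ (ι i) * lookup u i ≡ [ j ≟ i ] * lookup u i + above i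
      split i with ι i ⪰? J | ι i ≟ J | j ≟ i
      ... | yes _ | yes _   | yes _    = sym (+-identityʳ _)
      ... | yes _ | yes i≡j | no  j≢i  = contradiction (sym (punchIn-injective s i j i≡j)) j≢i
      ... | yes _ | no  i≢j | yes refl = contradiction refl i≢j
      ... | yes _ | no  _   | no  _    = +-identityʳ _
      ... | no i∉ | _       | yes refl = contradiction (⪰-refl J) i∉
      ... | no _  | _       | no _     = refl

    -- A vertex above `J` would supply a child. The only neighbour of a leaf is its parent, which is
    -- not above it.
    leaf-nothing-above : Leaf j → ∀ i → ¬ i ≻ J
    leaf-nothing-above leaf i (i⪰J , i≢J) with child (pathToSink-isPath i) i⪰J i≢J
    ... | k , J~k , k⪰J , _ = parent-⋡ (subst (_⪰ J) (length-1⇒≡ leaf (neighbour J~k) (neighbour J~P)) k⪰J)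
      where
      neighbour : J ~ l → l ∈ filter (J ~?_) (allFin _)
      neighbour {l} = ∈-filter⁺ (J ~?_) (∈-allFin l)

    deg-cut : deg J ≡ sum (λ k → χ k * e J k) + E
    deg-cut = begin
      deg J                                              ≡⟨ sum-cong split ⟩
      sum (λ k → χ k * e J k + [ P ≟ k ] * E)
        ≡⟨ ∑-distrib-+ (λ k → χ k * e J k) (λ k → [ P ≟ k ] * E) ⟩
      sum (λ k → χ k * e J k) + sum (λ k → [ P ≟ k ] * E)
        ≡⟨ cong (sum (λ k → χ k * e J k) +_) (sum-δ P (λ _ → E)) ⟩
      sum (λ k → χ k * e J k) + E                        ∎
      where
      open ≡-Reasoning
      1* : ∀ {a} → a ≡ 1 → ∀ n → a * n ≡ n
      1* refl = *-identityˡ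
      χJ : χ J ≡ 1
      χJ = []-true (J ⪰? J) (⪰-refl J)
      split : ∀ k → e J k ≡ χ k * e J k + [ P ≟ k ] * E
      split k = begin
        e J k                                                 ≡⟨ 1* χJ (e J k) ⟨
        χ J * e J k                                           ≡⟨ cut-edge J k ⟩
        χ J * (χ k * e J k) + [ J ≟ J ] * ([ P ≟ k ] * E)
          ≡⟨ cong₂ _+_ (1* χJ (χ k * e J k)) (1* ([]-true (J ≟ J) refl) ([ P ≟ k ] * E)) ⟩
        χ k * e J k + [ P ≟ k ] * E                           ∎

    -- Constraints on recurrent and idempotent configurations

    deg-above : i ≻ J → deg i ≡ sum (λ k → χ k * e i k)
    deg-above {i} (i⪰J , i≢J) =
      sum-cong λ k → sym (χ-closed {i} {k} i⪰J λ i≡J → contradiction i≡J i≢J)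

    recurrent-lower-bound : Recurrent u → deg J ≤ lookup u j + E
    -- Starting from the degrees makes every vertex unstable whatever `w` is, so each non-sink
    -- vertex topples on the way to `u`.
    recurrent-lower-bound {u} rec with rec (tabulate (deg ∘ ι))
    ... | w , r , stable with no-forbidden-subset r χ ([]≤1 ∘ (_⪰? J)) χ≤f
                                (≤-reflexive (sym ([]-true (J ⪰? J) (⪰-refl J))))
      where
      unstable : ∀ i → Unstable (zipWith _+_ (tabulate (deg ∘ ι)) w) i
      unstable i rewrite lookup-zipWith _+_ i (tabulate (deg ∘ ι)) w | lookup∘tabulate (deg ∘ ι) i =
        m≤m+n _ _
      χ≤f : ∀ k → χ k ≤ fires r k
      χ≤f k with s ≟ k
      ... | yes refl = ≤-trans (≤-reflexive χ-sink) z≤n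
      ... | no s≢k = subst (λ k → χ k ≤ fires r k) (punchIn-punchOut s≢k)
        (≤-trans ([]≤1 (ι (punchOut s≢k) ⪰? J)) (fires-all r unstable stable (punchOut s≢k)))
    ... | i , 1≤χi , bound = conclude (ι i ⪰? J) (i ≟ j)
      where
      bound′ : sum (λ k → χ k * e (ι i) k) ≤ lookup u i
      bound′ = subst (_≤ lookup u i) (sum-cong (λ k → cong (χ k *_) (e-sym k (ι i)))) bound
      conclude : Dec (ι i ⪰ J) → Dec (i ≡ j) → deg J ≤ lookup u j + E
      conclude (no i∉) _ = contradiction (subst (1 ≤_) ([]-false (ι i ⪰? J) i∉) 1≤χi) λ ()
      -- All edges at a vertex strictly above `J` stay in A, so the bound would make that vertex
      -- unstable.
      conclude (yes i⪰J) (no i≢j) = contradiction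
        (subst (_≤ lookup u i) (sym (deg-above (i⪰J , i≢j ∘ punchIn-injective s i j))) bound′)
        (<⇒≱ (stable i))
      conclude (yes _) (yes refl) = ≤-trans (≤-reflexive deg-cut) (+-monoˡ-≤ E bound′)

    idempotent⇒divides : u ⊕ u ≐ u → E ∣ lookup u j + sumAbove u j
    idempotent⇒divides {u} (r , _) = ∣m+n∣m⇒∣n
      (subst (E ∣_) telescoped (n∣m*n (f J))) (n∣m*n (f P))
      where
      open ≡-Reasoning
      open +-*-Solver
      f : V → ℕ
      f = fires r
      interior : (V → V → ℕ) → ℕ
      interior g = sum (λ v → sum (λ k → χ v * χ k * (g v k * e v k)))

      -- The sequence runs from u + u to u, so one copy of u cancels, leaving u = Δf.
      laplacian : ∀ i → f (ι i) * deg (ι i) ≡ lookup u i + sum (λ k → f k * e k (ι i))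
      laplacian i = +-cancelˡ-≡ (lookup u i) _ _
        (trans (balance r i) (trans (cong (_+ sum (λ k → f k * e k (ι i))) (lookup-zipWith _+_ i u u))
                                    (+-assoc (lookup u i) _ _)))

      -- The sink is outside A, so it can be added to the range of summation.
      sum-χ-V : (h : V → ℕ) → sum (λ i → χ (ι i) * h (ι i)) ≡ sum (λ v → χ v * h v)
      sum-χ-V h = sym (sum-punchIn s (λ v → χ v * h v) (cong (_* h s) χ-sink))

      -- Exchanging the two ends of each edge inside A matches chips sent with chips received.
      interior-sym : interior (λ v k → f v) ≡ interior (λ v k → f k)
      interior-sym = trans (∑-comm (λ v k → χ v * χ k * (f v * e v k)))
        (sum-cong λ v → sum-cong λ k →
          cong₂ _*_ (*-comm (χ k) (χ v)) (cong (f k *_) (e-sym k v)))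

      out : sum (λ i → χ (ι i) * (f (ι i) * deg (ι i))) ≡ interior (λ v k → f v) + f J * E
      out = begin
        sum (λ i → χ (ι i) * (f (ι i) * deg (ι i)))     ≡⟨ sum-χ-V (λ v → f v * deg v) ⟩
        sum (λ v → χ v * (f v * deg v))
          ≡⟨ sum-cong (λ v → trans (cong (χ v *_) (*-distribˡ-sum (f v) (e v)))
                                     (*-distribˡ-sum (χ v) (λ k → f v * e v k))) ⟩
        sum (λ v → sum (λ k → χ v * (f v * e v k)))     ≡⟨ sum-cut (λ v k → f v) ⟩
        interior (λ v k → f v) + f J * E                ∎

      inn : sum (λ i → χ (ι i) * sum (λ k → f k * e k (ι i))) ≡ interior (λ v k → f k) + f P * E
      inn = begin
        sum (λ i → χ (ι i) * sum (λ k → f k * e k (ι i))) ≡⟨ sum-χ-V (λ v → sum (λ k → f k * e k v)) ⟩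
        sum (λ v → χ v * sum (λ k → f k * e k v))
          ≡⟨ sum-cong (λ v → trans (*-distribˡ-sum (χ v) (λ k → f k * e k v))
                                     (sum-cong λ k → cong (λ x → χ v * (f k * x)) (e-sym k v))) ⟩
        sum (λ v → sum (λ k → χ v * (f k * e v k)))     ≡⟨ sum-cut (λ v k → f k) ⟩
        interior (λ v k → f k) + f P * E                ∎

      telescoped : f J * E ≡ f P * E + (lookup u j + sumAbove u j)
      telescoped = +-cancelˡ-≡ (interior (λ v k → f v)) _ _ (begin
        interior (λ v k → f v) + f J * E
          ≡⟨ out ⟨
        sum (λ i → χ (ι i) * (f (ι i) * deg (ι i)))
          ≡⟨ sum-cong (λ i → trans (cong (χ (ι i) *_) (laplacian i)) (*-distribˡ-+ (χ (ι i)) (lookup u i) _)) ⟩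
        sum (λ i → χ (ι i) * lookup u i + χ (ι i) * sum (λ k → f k * e k (ι i)))
          ≡⟨ ∑-distrib-+ (λ i → χ (ι i) * lookup u i) _ ⟩
        sum (λ i → χ (ι i) * lookup u i) + sum (λ i → χ (ι i) * sum (λ k → f k * e k (ι i)))
          ≡⟨ cong₂ _+_ (sum-χ u) (trans inn (cong (_+ f P * E) (sym interior-sym))) ⟩
        lookup u j + sumAbove u j + (interior (λ v k → f v) + f P * E)
          ≡⟨ solve 3 (λ t i b → t :+ (i :+ b) := i :+ (b :+ t)) refl
               (lookup u j + sumAbove u j) (interior (λ v k → f v)) (f P * E) ⟩
        interior (λ v k → f v) + (f P * E + (lookup u j + sumAbove u j)) ∎)

    -- Stability and `recurrent-lower-bound` confine the value at `j` to `E` consecutive integers,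
    -- so the quotient supplied by divisibility can only be `lam u j`.
    idempotent-recurrent : Recurrent u → u ⊕ u ≐ u → lookup u j + sumAbove u j ≡ lam u j * E
    idempotent-recurrent {u} rec idem@(_ , stable) = by-quotient (idempotent⇒divides idem)
      where
      by-quotient : E ∣ lookup u j + sumAbove u j → lookup u j + sumAbove u j ≡ lam u j * E
      by-quotient (divides q eq) = trans eq (cong (_* E) (sym
        (quotient-in-window (lookup u j) (sumAbove u j) q (stable j) (recurrent-lower-bound rec) eq)))

    idempotent-looplessLeaf : u ⊕ u ≐ u → LooplessLeaf j → lookup u j ≡ 0
    idempotent-looplessLeaf {u} idem@(_ , stable) (leaf , loopless) =
      multiple<⇒≡0 (subst (E ∣_) (trans (cong (lookup u j +_) S≡0) (+-identityʳ _)) (idempotent⇒divides idem))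
                   (subst (lookup u j <_) deg≡E (stable j))
      where
      S≡0 : sumAbove u j ≡ 0
      S≡0 = sum-zero _ λ i → cong (if_then lookup u i else 0) (dec-false (ι i ≻? J) (leaf-nothing-above leaf (ι i)))
      no-edge-above : ∀ k → χ k * e J k ≡ 0
      no-edge-above k with k ⪰? J | k ≟ J
      ... | no  _   | _        = refl
      ... | yes _   | yes refl = trans (*-identityˡ _) loopless
      ... | yes k⪰J | no k≢J   = contradiction (k⪰J , k≢J) (leaf-nothing-above leaf k)
      -- With no loops and nothing above, every edge at `J` goes to `P`.
      deg≡E : deg J ≡ E
      deg≡E = trans deg-cut (cong (_+ E) (sum-zero _ no-edge-above))

-- Imported only here: + would make sections such as (x +_) ambiguous above.
open import Data.Integer.Base using (+_; _-_; _⊖_)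

corollary3p6 : ∀ {m : ℕ} (T : ThickTree m) → let open Sandpile T in
    (eᵀ : Config) → IsIdentity eᵀ → (j : V₀) →
    (LooplessLeaf j → lookup eᵀ j ≡ 0)
    × (¬ LooplessLeaf j →
    + lookup eᵀ j ≡ + (lam eᵀ j * e (ι j) (p j)) - + sumAbove eᵀ j)
corollary3p6 T eᵀ (rec , id-law) j =
  idempotent-looplessLeaf T j idem , λ _ → begin
    + x                    ≡⟨ cong +_ (m+n∸n≡m x S) ⟨
    -- Adding `S` first keeps the natural difference exact, so it agrees with the integer one.
    + (x + S ∸ S)          ≡⟨ ℤ.⊖-≥ (m≤n+m S x) ⟨
    (x + S) ⊖ S            ≡⟨ ℤ.m-n≡m⊖n (x + S) S ⟨
    + (x + S) - + S        ≡⟨ cong (λ y → + y - + S) (idempotent-recurrent T j rec idem) ⟩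
    + (lam eᵀ j * e (ι j) (p j)) - + S ∎
  where
  open Sandpile T
  open ≡-Reasoning
  x = lookup eᵀ j
  S = sumAbove eᵀ j
  idem : eᵀ ⊕ eᵀ ≐ eᵀ
  idem = proj₁ (id-law eᵀ rec)
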